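{- The expected values $E_N^{rat}$ and $E_N^{rat-sym}$ of the $N$th rational complexity and of the $N$th symmetric rational complexity satisfy $$E_N^{rat-sym}\le E_N^{rat}-\frac{3N}{8}+O(1).$$ That is, there is an absolute constant $C$ such that $E_N^{rat-sym}\le E_N^{rat}-\frac{3N}{8}+C$ for all integers $N\ge 2$.
   Context: For a binary vector $\mathcal{S}_N=(s_0,\ldots,s_{N-1})\in\{0,1\}^N$, the $N$th rational complexity is $$\Lambda(\mathcal{S}_N)=\min\left\{\max\{q,|f|\}: q\sum_{n=0}^{N-1}s_n2^n\equiv f\bmod 2^N,\ q>0 \mbox{ odd}\right\},$$ where $q,f$ range over integers. The reverse of $\mathcal{S}_N$ is $\mathcal{S}_N^{rev}=(s_{N-1},s_{N-2},\ldots,s_0)$. For $N\ge 2$ the symmetric rational complexity is $\Lambda^{sym}(\mathcal{S}_N)=\min\{\Lambda(\mathcal{S}_N),\Lambda(\mathcal{S}_N^{rev})\}$. The expected values are $$E_N^{rat}=\frac{1}{2^N}\sum_{\mathcal{S}_N\in\{0,1\}^N}\Lambda(\mathcal{S}_N),\qquad E_N^{rat-sym}=\frac{1}{2^N}\sum_{\mathcal{S}_N\in\{0,1\}^N}\Lambda^{sym}(\mathcal{S}_N).$$ -}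

module Defs where

open import Data.Fin.Base using (Fin; toℕ)
open import Data.Integer.Base as ℤ using (ℤ; +_; -_; 0ℤ; 1ℤ; ∣_∣)
import Data.Integer.Properties as ℤ
open import Data.Integer.Divisibility.Signed using (_∣_; _∣?_; divides)
open import Data.List.Base as List using (List; allFin; cartesianProductWith)
open import Data.Nat.Base as ℕ using (ℕ; zero; suc; _+_; _*_; _^_; _⊔_; _⊓_; _≤_; _<_; s≤s; z<s)
import Data.Nat.ListAction as ℕ
import Data.Nat.Properties as ℕ
open import Data.Product.Base using (_×_; _,_; proj₁; proj₂; ∃; ∃₂)
open import Data.Rational.Base using (ℚ; _/_)
open import Data.Sum.Base using (_⊎_; inj₁; inj₂)
open import Data.Vec.Base as Vec using (Vec; []; _∷_; lookup; tabulate; reverse)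
open import Function.Base using (_∘_)
open import Level using (Level)
open import Relation.Binary.PropositionalEquality
  using (_≡_; refl; sym; subst)
open import Relation.Nullary.Decidable using (Dec; yes; no; map′; _×-dec_; _⊎-dec_; ¬?; from-no)
open import Relation.Nullary.Negation using (¬_; contradiction)
open import Relation.Unary using (Pred; Decidable)

private
  variable
    ℓ : Level
    N : ℕ

IsMinimum : Pred ℕ ℓ → ℕ → Set ℓ
IsMinimum P m = P m × (∀ {k} → P k → m ≤ k)

minimum : {P : Pred ℕ ℓ} → Decidable P → ∃ P → ∃ (IsMinimum P)
minimum {P = P} P? (n , Pn) = search n P P? Pn
  where
  search : ∀ n (Q : Pred ℕ _) → Decidable Q → Q n → ∃ (IsMinimum Q)
  search n Q Q? Qn with Q? 0
  search n       Q Q? Qn | yes Q0 = 0 , Q0 , λ _ → ℕ.z≤n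
  search zero    Q Q? Qn | no ¬Q0 = contradiction Qn ¬Q0
  search (suc n) Q Q? Qn | no ¬Q0 with search n (Q ∘ suc) (Q? ∘ suc) Qn
  ... | m , Qm , least = suc m , Qm , least′
    where
    least′ : ∀ {k} → Q k → suc m ≤ k
    least′ {zero}  Q0 = contradiction Q0 ¬Q0
    least′ {suc _} Qk = s≤s (least Qk)

infix 4 _≡_mod_

_≡_mod_ : ℤ → ℤ → ℕ → Set
a ≡ b mod m = + m ∣ a ℤ.- b

Odd : ℤ → Set
Odd q = ¬ (+ 2 ∣ q)

BinaryVector : ℕ → Set
BinaryVector = Vec (Fin 2)

value : BinaryVector N → ℕ
value s = Vec.sum (tabulate λ n → toℕ (lookup s n) * 2 ^ toℕ n)

Represents : BinaryVector N → ℤ → ℤ → Set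
Represents {N} s q f =
  (q ℤ.* + value s ≡ f mod (2 ^ N)) × 0ℤ ℤ.< q × Odd q

represents? : (s : BinaryVector N) (q f : ℤ) → Dec (Represents s q f)
represents? {N} s q f =
  (+ (2 ^ N) ∣? (q ℤ.* + value s ℤ.- f)) ×-dec (0ℤ ℤ.<? q) ×-dec ¬? (+ 2 ∣? q)

-- ∣ q ∣ stands for q, which is positive here; it keeps the maximum in ℕ.
Candidate : BinaryVector N → Pred ℕ _
Candidate s m = ∃₂ λ (q f : ℤ) → Represents s q f × m ≡ ∣ q ∣ ⊔ ∣ f ∣

private
  anyℤ≤? : {P : Pred ℤ ℓ} → Decidable P →
           (m : ℕ) → Dec (∃ λ i → ∣ i ∣ ≤ m × P i)
  anyℤ≤? {P = P} P? m =
    map′ to from (ℕ.anyUpTo? (λ n → P? (+ n) ⊎-dec P? (- (+ n))) (suc m))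
    where
    Bounded = ∃ λ i → ∣ i ∣ ≤ m × P i
    to : (∃ λ n → n < suc m × (P (+ n) ⊎ P (- (+ n)))) → Bounded
    to (n , s≤s n≤m , inj₁ p) = + n , n≤m , p
    to (n , s≤s n≤m , inj₂ p) =
      - (+ n) , subst (_≤ m) (sym (ℤ.∣-i∣≡∣i∣ (+ n))) n≤m , p
    from : Bounded → ∃ λ n → n < suc m × (P (+ n) ⊎ P (- (+ n)))
    from (+ n        , n≤m , p) = n , s≤s n≤m , inj₁ p
    from (ℤ.-[1+ n ] , n≤m , p) = suc n , s≤s n≤m , inj₂ p

candidate? : (s : BinaryVector N) → Decidable (Candidate s)
candidate? s m = map′
  (λ (q , _ , f , _ , r , eq) → q , f , r , eq)
  (λ (q , f , r , eq) →
    q , subst (∣ q ∣ ≤_) (sym eq) (ℕ.m≤m⊔n ∣ q ∣ ∣ f ∣) ,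
    f , subst (∣ f ∣ ≤_) (sym eq) (ℕ.m≤n⊔m ∣ q ∣ ∣ f ∣) , r , eq)
  (anyℤ≤? (λ q → anyℤ≤? (λ f →
    represents? s q f ×-dec (m ℕ.≟ ∣ q ∣ ⊔ ∣ f ∣)) m) m)

candidate-exists : (s : BinaryVector N) → ∃ (Candidate s)
candidate-exists {N} s =
  _ , 1ℤ , + value s ,
  ( divides 0ℤ (ℤ.i≡j⇒i-j≡0 (ℤ.*-identityˡ (+ value s)))
  , ℤ.+<+ z<s
  , from-no (+ 2 ∣? 1ℤ)
  ) , refl

rationalComplexity : (s : BinaryVector N) → ∃ (IsMinimum (Candidate s))
rationalComplexity s = minimum (candidate? s) (candidate-exists s)

Λ : BinaryVector N → ℕ
Λ s = proj₁ (rationalComplexity s)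

Λ-isMinimum : (s : BinaryVector N) → IsMinimum (Candidate s) (Λ s)
Λ-isMinimum s = proj₂ (rationalComplexity s)

Λˢʸᵐ : BinaryVector N → ℕ
Λˢʸᵐ s = Λ s ⊓ Λ (reverse s)

binaryVectors : ∀ N → List (BinaryVector N)
binaryVectors zero    = [] List.∷ List.[]
binaryVectors (suc N) = cartesianProductWith _∷_ (allFin 2) (binaryVectors N)

mean : (BinaryVector N → ℕ) → ℚ
mean {N} X = _/_ (+ ℕ.sum (List.map X (binaryVectors N))) (2 ^ N) {{ℕ.m^n≢0 2 N}}

Eʳᵃᵗ : ℕ → ℚ
Eʳᵃᵗ N = mean {N} Λ

Eʳᵃᵗ⁻ˢʸᵐ : ℕ → ℚ
Eʳᵃᵗ⁻ˢʸᵐ N = mean {N} Λˢʸᵐ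

{-# OPTIONS --safe #-}

-- If s starts with exactly j equal bits and k = N − j − 1 bits follow the first different one,
-- then the reverse of s ends in a constant run of length j, so q = 1 gives Λ (reverse s) ≤ 2^(k+1).
-- On the other hand q · value s is an odd multiple of 2^j (run of zeros), respectively q less
-- than such a multiple (run of ones), so Λ s ≥ 2^j, respectively 2 Λ s ≥ 2^j. There are 2^k
-- vectors of each kind; hence every k < N/2 contributes about 1/2 + 1/4 to the mean of
-- Λ − Λˢʸᵐ, up to a geometric error, and 3/4 · N/2 = 3N/8.
module Submission where

open import Defs
open import Data.Integer.Base using (+_)
open import Data.Nat.Base as ℕ using (ℕ)
open import Data.Product.Base using (∃)
open import Data.Rational.Base as ℚ using (ℚ; _/_; _+_; _-_; _≤_)

open import Data.Fin.Base as Fin using (Fin; toℕ; opposite)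
open import Data.Fin.Patterns using (0F; 1F)
import Data.Fin.Properties as Fin
open import Data.Integer.Base as ℤ using (ℤ; 0ℤ; 1ℤ; ∣_∣)
open import Data.Integer.Divisibility.Signed as ℤ using (divides)
import Data.Integer.Properties as ℤ
import Data.Integer.Tactic.RingSolver as ℤ-Ring
open import Data.List.Base as List using (List)
import Data.List.Properties as List
import Data.Nat.Divisibility as ℕ
import Data.Nat.ListAction as ℕ
import Data.Nat.ListAction.Properties as ℕ
import Data.Nat.Properties as ℕ
import Data.Nat.Tactic.RingSolver as ℕ-Ring
open import Data.Product.Base using (_,_; proj₁; proj₂)
import Data.Rational.Properties as ℚ
open import Data.Rational.Unnormalised.Base as ℚᵘ using (mkℚᵘ)
import Data.Rational.Unnormalised.Properties as ℚᵘ
open import Data.Sum.Base using (inj₁; inj₂)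
open import Data.Vec.Base as Vec using ([]; _∷_; _∷ʳ_; lookup; tabulate; reverse)
import Data.Vec.Properties as Vec
open import Function.Base using (_∘_)
open import Relation.Binary.PropositionalEquality
  using (_≡_; refl; sym; trans; cong; cong₂; subst; module ≡-Reasoning)
open import Relation.Nullary.Decidable using (from-no)

private
  variable
    a d j k n : ℕ
    b : Fin 2

-- Sums over all binary vectors.

total : (BinaryVector n → ℕ) → ℕ
total {n} X = ℕ.sum (List.map X (binaryVectors n))

-- Putting an arbitrary bit `b` first lets runs of zeros and runs of ones share one induction.
total-suc : (X : BinaryVector (ℕ.suc n) → ℕ) (b : Fin 2) →
            total X ≡ total (X ∘ (b ∷_)) ℕ.+ total (X ∘ (opposite b ∷_))
total-suc {n} X = λ where
    0F           → by-first-bit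
    1F → trans by-first-bit (ℕ.+-comm (total (X ∘ (0F ∷_))) _)
  where
  open ≡-Reasoning
  ws = binaryVectors n
  cons : Fin 2 → List (BinaryVector (ℕ.suc n))
  cons b = List.map (b ∷_) ws
  by-first-bit : total X ≡ total (X ∘ (0F ∷_)) ℕ.+ total (X ∘ (1F ∷_))
  by-first-bit = begin
    ℕ.sum (List.map X (cons 0F List.++ (cons 1F List.++ List.[])))
      ≡⟨ cong (λ vs → ℕ.sum (List.map X (cons 0F List.++ vs))) (List.++-identityʳ _) ⟩
    ℕ.sum (List.map X (cons 0F List.++ cons 1F))
      ≡⟨ cong ℕ.sum (List.map-++ X (cons 0F) _) ⟩
    ℕ.sum (List.map X (cons 0F) List.++ List.map X (cons 1F))
      ≡⟨ ℕ.sum-++ (List.map X (cons 0F)) _ ⟩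
    ℕ.sum (List.map X (cons 0F)) ℕ.+ ℕ.sum (List.map X (cons 1F))
      ≡⟨ cong₂ (λ xs ys → ℕ.sum xs ℕ.+ ℕ.sum ys) (sym (List.map-∘ ws)) (sym (List.map-∘ ws)) ⟩
    total (X ∘ (0F ∷_)) ℕ.+ total (X ∘ (1F ∷_)) ∎

total-+ : (X Y : BinaryVector n → ℕ) → total (λ s → X s ℕ.+ Y s) ≡ total X ℕ.+ total Y
total-+ {n} X Y = go (binaryVectors n)
  where
  go : ∀ ws → ℕ.sum (List.map (λ s → X s ℕ.+ Y s) ws) ≡ ℕ.sum (List.map X ws) ℕ.+ ℕ.sum (List.map Y ws)
  go List.[] = refl
  go (w List.∷ ws) rewrite go ws = interchange (X w) (Y w) _ _
    where
    interchange : ∀ x y u v → (x ℕ.+ y) ℕ.+ (u ℕ.+ v) ≡ (x ℕ.+ u) ℕ.+ (y ℕ.+ v)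
    interchange = ℕ-Ring.solve-∀

total-cong : {X Y : BinaryVector n → ℕ} → (∀ s → X s ≡ Y s) → total X ≡ total Y
total-cong {n} X≗Y = cong ℕ.sum (List.map-cong X≗Y (binaryVectors n))

total-double : (X : BinaryVector n → ℕ) → total (λ s → 2 ℕ.* X s) ≡ total X ℕ.+ total X
total-double X = trans (total-cong (λ s → cong (X s ℕ.+_) (ℕ.+-identityʳ (X s)))) (total-+ X X)

-- Averaging the hypothesis over all `2 ^ n` vectors gives this: the weight `2 ^ n` turns the mean
-- of `X` into its total, while `a` and `d` are constants. The induction averages over one bit at a
-- time.
total-≥ : (X : BinaryVector n → ℕ) → (∀ u → a ℕ.≤ 2 ℕ.^ n ℕ.* X u ℕ.+ d) → a ℕ.≤ total X ℕ.+ d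
total-≥ {ℕ.zero}          X bound = bound []
total-≥ {ℕ.suc n} {a} {d} X bound = begin
  a                                   ≤⟨ total-≥ Y bound′ ⟩
  total Y ℕ.+ d                       ≡⟨ cong (ℕ._+ d) (total-+ (X ∘ (0F ∷_)) _) ⟩
  total (X ∘ (0F ∷_)) ℕ.+ total (X ∘ (1F ∷_)) ℕ.+ d
                                      ≡⟨ cong (ℕ._+ d) (sym (total-suc X 0F)) ⟩
  total X ℕ.+ d                       ∎
  where
  open ℕ.≤-Reasoning
  Y : BinaryVector n → ℕ
  Y u = X (0F ∷ u) ℕ.+ X (1F ∷ u)
  rearrange : ∀ p x y d → (2 ℕ.* p ℕ.* x ℕ.+ d) ℕ.+ (2 ℕ.* p ℕ.* y ℕ.+ d) ≡ 2 ℕ.* (p ℕ.* (x ℕ.+ y) ℕ.+ d)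
  rearrange = ℕ-Ring.solve-∀
  bound′ : ∀ u → a ℕ.≤ 2 ℕ.^ n ℕ.* Y u ℕ.+ d
  bound′ u = ℕ.*-cancelˡ-≤ 2 (begin
    2 ℕ.* a     ≡⟨ cong (a ℕ.+_) (ℕ.+-identityʳ a) ⟩
    a ℕ.+ a     ≤⟨ ℕ.+-mono-≤ (bound (0F ∷ u)) (bound (1F ∷ u)) ⟩
    _           ≡⟨ rearrange (2 ℕ.^ n) (X (0F ∷ u)) _ d ⟩
    2 ℕ.* (2 ℕ.^ n ℕ.* Y u ℕ.+ d) ∎)

-- Vectors with an initial constant run, and sums over them.

-- Run b j k t says that t consists of j copies of b, one other bit, and k arbitrary bits.
data Run (b : Fin 2) : ℕ → ℕ → BinaryVector n → Set where
  change : (u : BinaryVector k) → Run b 0 k (opposite b ∷ u)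
  extend : {t : BinaryVector n} → Run b j k t → Run b (ℕ.suc j) k (b ∷ t)

run-length : {t : BinaryVector n} → Run b j k t → j ℕ.+ ℕ.suc k ≡ n
run-length (change u) = refl
run-length (extend r) = cong ℕ.suc (run-length r)

run-< : {t : BinaryVector n} → Run b j k t → j ℕ.< n
run-< (change u) = ℕ.z<s
run-< (extend r) = ℕ.s<s (run-< r)

2^j*2^1+k : {t : BinaryVector n} → Run b j k t → 2 ℕ.^ j ℕ.* 2 ℕ.^ ℕ.suc k ≡ 2 ℕ.^ n
2^j*2^1+k {j = j} {k} r = trans (sym (ℕ.^-distribˡ-+-* 2 j (ℕ.suc k))) (cong (2 ℕ.^_) (run-length r))

-- Each k below h contributes at least a, up to the geometric error d * 4 ^ h,
-- because there are 2 ^ k vectors of shape Run b j k.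
total-runs : ∀ (b : Fin 2) {h} → h ℕ.≤ n → (X : BinaryVector n → ℕ) →
             (∀ {j k t} → Run b j k t → a ℕ.≤ 2 ℕ.^ k ℕ.* X t ℕ.+ d ℕ.* 4 ℕ.^ k) →
             h ℕ.* a ℕ.≤ total X ℕ.+ d ℕ.* 4 ℕ.^ h
total-runs {ℕ.zero} b ℕ.z≤n X bound = ℕ.z≤n
total-runs {ℕ.suc n} {a} {d} b {h} h≤ X bound with ℕ.m≤n⇒m<n∨m≡n h≤
-- Vectors beginning with `opposite b` have `k ≥ h` here, so their nonnegative share is dropped.
... | inj₁ (ℕ.s≤s h≤n) = begin
  h ℕ.* a                                  ≤⟨ total-runs {d = d} b h≤n (X ∘ (b ∷_)) (bound ∘ extend) ⟩
  total (X ∘ (b ∷_)) ℕ.+ d ℕ.* 4 ℕ.^ h     ≤⟨ ℕ.+-monoˡ-≤ (d ℕ.* 4 ℕ.^ h) (ℕ.m≤m+n (total (X ∘ (b ∷_))) (total (X ∘ (opposite b ∷_)))) ⟩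
  total (X ∘ (b ∷_)) ℕ.+ total (X ∘ (opposite b ∷_)) ℕ.+ d ℕ.* 4 ℕ.^ h
                                           ≡⟨ cong (ℕ._+ d ℕ.* 4 ℕ.^ h) (sym (total-suc X b)) ⟩
  total X ℕ.+ d ℕ.* 4 ℕ.^ h                ∎
  where open ℕ.≤-Reasoning
-- Now vectors beginning with `opposite b` realise the largest counted `k`, namely `n`, and
-- `total-≥` averages over them.
... | inj₂ refl = begin
  a ℕ.+ n ℕ.* a
    ≤⟨ ℕ.+-mono-≤ (total-≥ (X ∘ (opposite b ∷_)) (bound ∘ change))
                  (total-runs {d = d} b ℕ.≤-refl (X ∘ (b ∷_)) (bound ∘ extend)) ⟩
  (Σ₁ ℕ.+ d ℕ.* 4 ℕ.^ n) ℕ.+ (Σ₀ ℕ.+ d ℕ.* 4 ℕ.^ n)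
    -- Two error terms `d * 4 ^ n` are padded to four, which make up the error for `suc n`.
    ≤⟨ ℕ.m≤m+n _ (2 ℕ.* (d ℕ.* 4 ℕ.^ n)) ⟩
  (Σ₁ ℕ.+ d ℕ.* 4 ℕ.^ n) ℕ.+ (Σ₀ ℕ.+ d ℕ.* 4 ℕ.^ n) ℕ.+ 2 ℕ.* (d ℕ.* 4 ℕ.^ n)
    ≡⟨ rearrange Σ₀ Σ₁ d (4 ℕ.^ n) ⟩
  Σ₀ ℕ.+ Σ₁ ℕ.+ d ℕ.* 4 ℕ.^ ℕ.suc n
    ≡⟨ cong (ℕ._+ d ℕ.* 4 ℕ.^ ℕ.suc n) (sym (total-suc X b)) ⟩
  total X ℕ.+ d ℕ.* 4 ℕ.^ ℕ.suc n ∎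
  where
  open ℕ.≤-Reasoning
  Σ₀ = total (X ∘ (b ∷_))
  Σ₁ = total (X ∘ (opposite b ∷_))
  rearrange : ∀ x y d q → (y ℕ.+ d ℕ.* q) ℕ.+ (x ℕ.+ d ℕ.* q) ℕ.+ 2 ℕ.* (d ℕ.* q) ≡ x ℕ.+ y ℕ.+ d ℕ.* (4 ℕ.* q)
  rearrange = ℕ-Ring.solve-∀

-- Values of vectors with an initial run, and of their reverses.

value-∷ : ∀ x (t : BinaryVector n) → value (x ∷ t) ≡ toℕ x ℕ.+ 2 ℕ.* value t
value-∷ x t = cong₂ ℕ._+_ (ℕ.*-identityʳ (toℕ x)) (doubled t (λ m → 2 ℕ.^ toℕ m))
  where
  -- Arbitrary weights `w` allow the induction to pass to the shifted weights `w ∘ Fin.suc`.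
  doubled : ∀ {n} (t : BinaryVector n) (w : Fin n → ℕ) →
            Vec.sum (tabulate λ m → toℕ (lookup t m) ℕ.* (2 ℕ.* w m)) ≡
            2 ℕ.* Vec.sum (tabulate λ m → toℕ (lookup t m) ℕ.* w m)
  doubled []      w = refl
  doubled (x ∷ t) w = trans (cong (toℕ x ℕ.* (2 ℕ.* w 0F) ℕ.+_) (doubled t (w ∘ Fin.suc)))
                            (factor (toℕ x) (w 0F) _)
    where
    factor : ∀ x w y → x ℕ.* (2 ℕ.* w) ℕ.+ 2 ℕ.* y ≡ 2 ℕ.* (x ℕ.* w ℕ.+ y)
    factor = ℕ-Ring.solve-∀

value-∷ʳ : ∀ (t : BinaryVector n) x → value (t ∷ʳ x) ≡ value t ℕ.+ toℕ x ℕ.* 2 ℕ.^ n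
value-∷ʳ []      x = trans (value-∷ x []) (base (toℕ x))
  where
  base : ∀ x → x ℕ.+ 0 ≡ x ℕ.* 1
  base = ℕ-Ring.solve-∀
value-∷ʳ {ℕ.suc n} (y ∷ t) x = begin
  value (y ∷ (t ∷ʳ x))                                  ≡⟨ value-∷ y (t ∷ʳ x) ⟩
  toℕ y ℕ.+ 2 ℕ.* value (t ∷ʳ x)                        ≡⟨ cong (λ v → toℕ y ℕ.+ 2 ℕ.* v) (value-∷ʳ t x) ⟩
  toℕ y ℕ.+ 2 ℕ.* (value t ℕ.+ toℕ x ℕ.* 2 ℕ.^ n)       ≡⟨ rearrange (toℕ y) (value t) (toℕ x) (2 ℕ.^ n) ⟩
  (toℕ y ℕ.+ 2 ℕ.* value t) ℕ.+ toℕ x ℕ.* 2 ℕ.^ ℕ.suc n ≡⟨ cong (ℕ._+ toℕ x ℕ.* 2 ℕ.^ ℕ.suc n) (sym (value-∷ y t)) ⟩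
  value (y ∷ t) ℕ.+ toℕ x ℕ.* 2 ℕ.^ ℕ.suc n             ∎
  where
  open ≡-Reasoning
  rearrange : ∀ y v x p → y ℕ.+ 2 ℕ.* (v ℕ.+ x ℕ.* p) ≡ (y ℕ.+ 2 ℕ.* v) ℕ.+ x ℕ.* (2 ℕ.* p)
  rearrange = ℕ-Ring.solve-∀

value-reverse-∷ : ∀ x (t : BinaryVector n) →
                  value (reverse (x ∷ t)) ≡ value (reverse t) ℕ.+ toℕ x ℕ.* 2 ℕ.^ n
value-reverse-∷ x t = trans (cong value (Vec.reverse-∷ x t)) (value-∷ʳ (reverse t) x)

value<2^n : (t : BinaryVector n) → value t ℕ.< 2 ℕ.^ n
value<2^n []              = ℕ.s≤s ℕ.z≤n
value<2^n {ℕ.suc n} (x ∷ t) = begin-strict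
  value (x ∷ t)           ≡⟨ value-∷ x t ⟩
  toℕ x ℕ.+ 2 ℕ.* value t <⟨ ℕ.+-monoˡ-< _ (Fin.toℕ<n x) ⟩
  2 ℕ.+ 2 ℕ.* value t     ≡⟨ sym (ℕ.*-suc 2 (value t)) ⟩
  2 ℕ.* ℕ.suc (value t)   ≤⟨ ℕ.*-monoʳ-≤ 2 (value<2^n t) ⟩
  2 ℕ.^ ℕ.suc n           ∎
  where open ℕ.≤-Reasoning

-- The lowest set bit is at position `j`; the witness `v` is the value of the bits above it.
value-run-0 : {t : BinaryVector n} → Run 0F j k t →
              ∃ λ v → value t ≡ 2 ℕ.^ j ℕ.* (1 ℕ.+ 2 ℕ.* v)
value-run-0 (change u) = value u , trans (value-∷ 1F u) (sym (ℕ.*-identityˡ _))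
value-run-0 {j = ℕ.suc j} (extend {t = t} r) with value-run-0 r
... | v , eq = v , trans (value-∷ 0F t) (trans (cong (2 ℕ.*_) eq) (sym (ℕ.*-assoc 2 (2 ℕ.^ j) _)))

-- Adding 1 carries through the `j` ones and sets the zero that follows them.
value-run-1 : {t : BinaryVector n} → Run 1F j k t →
              ∃ λ v → value t ℕ.+ 1 ≡ 2 ℕ.^ j ℕ.* (1 ℕ.+ 2 ℕ.* v)
value-run-1 (change u) = value u , trans (cong (ℕ._+ 1) (value-∷ 0F u)) (base (value u))
  where
  base : ∀ v → 2 ℕ.* v ℕ.+ 1 ≡ 1 ℕ.* (1 ℕ.+ 2 ℕ.* v)
  base = ℕ-Ring.solve-∀
value-run-1 {j = ℕ.suc j} (extend {t = t} r) with value-run-1 r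
... | v , eq = v , (begin
  value (1F ∷ t) ℕ.+ 1   ≡⟨ cong (ℕ._+ 1) (value-∷ 1F t) ⟩
  1 ℕ.+ 2 ℕ.* value t ℕ.+ 1            ≡⟨ double (value t) ⟩
  2 ℕ.* (value t ℕ.+ 1)                ≡⟨ cong (2 ℕ.*_) eq ⟩
  2 ℕ.* (2 ℕ.^ j ℕ.* (1 ℕ.+ 2 ℕ.* v))  ≡⟨ sym (ℕ.*-assoc 2 (2 ℕ.^ j) _) ⟩
  2 ℕ.^ ℕ.suc j ℕ.* (1 ℕ.+ 2 ℕ.* v)    ∎)
  where
  open ≡-Reasoning
  double : ∀ v → 1 ℕ.+ 2 ℕ.* v ℕ.+ 1 ≡ 2 ℕ.* (v ℕ.+ 1)
  double = ℕ-Ring.solve-∀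

-- Reversal moves the run to the `j` highest positions, so only the `k + 1` lowest bits can be set.
value-reverse-run-0 : {t : BinaryVector n} → Run 0F j k t →
                      value (reverse t) ℕ.< 2 ℕ.^ ℕ.suc k
value-reverse-run-0 (change u)         = value<2^n (reverse (1F ∷ u))
value-reverse-run-0 {k = k} (extend {t = t} r) =
  subst (ℕ._< 2 ℕ.^ ℕ.suc k) (sym (trans (value-reverse-∷ 0F t) (ℕ.+-identityʳ _))) (value-reverse-run-0 r)

-- After reversal the `j` highest bits are ones, so only the `k + 1` lowest bits can be missing from
-- `2 ^ n - 1`.
value-reverse-run-1 : {t : BinaryVector n} → Run 1F j k t →
                      2 ℕ.^ n ℕ.≤ value (reverse t) ℕ.+ 2 ℕ.^ ℕ.suc k
value-reverse-run-1 (change u)         = ℕ.m≤n+m _ (value (reverse (0F ∷ u)))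
value-reverse-run-1 {ℕ.suc n} {k = k} (extend {t = t} r) = begin
  2 ℕ.* 2 ℕ.^ n                                             ≡⟨ double (2 ℕ.^ n) ⟩
  2 ℕ.^ n ℕ.+ 2 ℕ.^ n                                       ≤⟨ ℕ.+-monoˡ-≤ (2 ℕ.^ n) (value-reverse-run-1 r) ⟩
  value (reverse t) ℕ.+ 2 ℕ.^ ℕ.suc k ℕ.+ 2 ℕ.^ n           ≡⟨ swap (value (reverse t)) _ (2 ℕ.^ n) ⟩
  value (reverse t) ℕ.+ 1 ℕ.* 2 ℕ.^ n ℕ.+ 2 ℕ.^ ℕ.suc k     ≡⟨ cong (ℕ._+ 2 ℕ.^ ℕ.suc k) (sym (value-reverse-∷ 1F t)) ⟩
  value (reverse (1F ∷ t)) ℕ.+ 2 ℕ.^ ℕ.suc k  ∎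
  where
  open ℕ.≤-Reasoning
  double : ∀ p → 2 ℕ.* p ≡ p ℕ.+ p
  double = ℕ-Ring.solve-∀
  swap : ∀ v q p → v ℕ.+ q ℕ.+ p ≡ v ℕ.+ 1 ℕ.* p ℕ.+ q
  swap = ℕ-Ring.solve-∀

-- Upper bounds for `Λ` of the reverse.

Λ≤ : (s : BinaryVector n) (f : ℤ) → + value s ≡ f mod (2 ℕ.^ n) →
     1 ℕ.≤ a → ∣ f ∣ ℕ.≤ a → Λ s ℕ.≤ a
Λ≤ {n} s f s≡f 1≤a f≤a = ℕ.≤-trans
  (proj₂ (Λ-isMinimum s)
    -- The denominator 1 also enters the maximum, whence the hypothesis `1 ≤ a`.
    ( 1ℤ , f
    , (subst (_≡ f mod (2 ℕ.^ n)) (sym (ℤ.*-identityˡ (+ value s))) s≡f , ℤ.+<+ ℕ.z<s , from-no (+ 2 ℤ.∣? 1ℤ))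
    , refl ))
  (ℕ.⊔-lub 1≤a f≤a)

Λ-reverse-run-0 : {t : BinaryVector n} → Run 0F j k t → Λ (reverse t) ℕ.≤ 2 ℕ.^ ℕ.suc k
Λ-reverse-run-0 {k = k} {t} r = Λ≤ (reverse t) (+ value (reverse t))
  (divides 0ℤ (ℤ.i≡j⇒i-j≡0 {i = + value (reverse t)} refl))
  (ℕ.m^n>0 2 (ℕ.suc k)) (ℕ.<⇒≤ (value-reverse-run-0 r))

Λ-reverse-run-1 : {t : BinaryVector n} → Run 1F j k t → Λ (reverse t) ℕ.≤ 2 ℕ.^ ℕ.suc k
-- When the high bits are ones, the negative residue `value - 2 ^ n` is the one known to be small.
Λ-reverse-run-1 {n} {k = k} {t} r = Λ≤ (reverse t) (+ value (reverse t) ℤ.- + (2 ℕ.^ n))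
  (divides 1ℤ (cancel (+ value (reverse t)) (+ (2 ℕ.^ n)))) (ℕ.m^n>0 2 (ℕ.suc k)) (begin
    ∣ + value (reverse t) ℤ.- + (2 ℕ.^ n) ∣ ≡⟨ cong ∣_∣ (ℤ.m-n≡m⊖n (value (reverse t)) (2 ℕ.^ n)) ⟩
    ∣ value (reverse t) ℤ.⊖ 2 ℕ.^ n ∣       ≡⟨ ℤ.∣⊖∣-≤ (ℕ.<⇒≤ (value<2^n (reverse t))) ⟩
    2 ℕ.^ n ℕ.∸ value (reverse t)           ≤⟨ ℕ.m≤n+o⇒m∸n≤o (2 ℕ.^ n) (value (reverse t)) (value-reverse-run-1 r) ⟩
    2 ℕ.^ ℕ.suc k                           ∎)
  where
  open ℕ.≤-Reasoning
  cancel : ∀ v p → v ℤ.- (v ℤ.- p) ≡ 1ℤ ℤ.* p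
  cancel = ℤ-Ring.solve-∀

-- Divisibility by powers of 2 and lower bounds for `Λ`.

2^-mono-∣ : j ℕ.≤ n → 2 ℕ.^ j ℕ.∣ 2 ℕ.^ n
2^-mono-∣ {j} {n} j≤n = ℕ.divides (2 ℕ.^ (n ℕ.∸ j))
  (trans (cong (2 ℕ.^_) (sym (ℕ.m∸n+n≡m j≤n))) (ℕ.^-distribˡ-+-* 2 (n ℕ.∸ j) j))

-- q x is an odd multiple of 2 ^ j, hence so is f; in particular f is nonzero.
odd-multiple-≤ : ∀ {q f : ℤ} {x v : ℕ} → j ℕ.< n → Odd q → x ≡ 2 ℕ.^ j ℕ.* (1 ℕ.+ 2 ℕ.* v) →
                 q ℤ.* + x ≡ f mod (2 ℕ.^ n) → 2 ℕ.^ j ℕ.≤ ∣ f ∣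
odd-multiple-≤ {j} {n} {q} {f} {x} {v} j<n odd refl qx≡f = ℕ.∣⇒≤ {{ℕ.≢-nonZero f≢0}} (ℤ.∣⇒∣ᵤ 2^j∣f)
  where
  power-∣ : ∀ {i} → i ℕ.≤ n → + (2 ℕ.^ i) ℤ.∣ q ℤ.* + x ℤ.- f
  power-∣ i≤n = ℤ.∣-trans (ℤ.∣ᵤ⇒∣ (2^-mono-∣ i≤n)) qx≡f
  w = q ℤ.* (1ℤ ℤ.+ + 2 ℤ.* + v)
  x≡ : + x ≡ + (2 ℕ.^ j) ℤ.* (1ℤ ℤ.+ + 2 ℤ.* + v)
  x≡ = trans (ℤ.pos-* (2 ℕ.^ j) _) (cong (λ y → + (2 ℕ.^ j) ℤ.* (1ℤ ℤ.+ y)) (ℤ.pos-* 2 v))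
  swap : ∀ q p y → q ℤ.* (p ℤ.* y) ≡ (q ℤ.* y) ℤ.* p
  swap = ℤ-Ring.solve-∀
  qx≡ : q ℤ.* + x ≡ w ℤ.* + (2 ℕ.^ j)
  qx≡ = trans (cong (q ℤ.*_) x≡) (swap q (+ (2 ℕ.^ j)) _)
  2^j∣f : + (2 ℕ.^ j) ℤ.∣ f
  2^j∣f = subst (_ ℤ.∣_) (difference (q ℤ.* + x) f)
    (ℤ.∣m∣n⇒∣m-n (divides w qx≡) (power-∣ (ℕ.<⇒≤ j<n)))
    where
    difference : ∀ y f → y ℤ.- (y ℤ.- f) ≡ f
    difference = ℤ-Ring.solve-∀
  -- If `f` vanished, `2 ^ (j + 1)`, which divides `2 ^ n` as `j < n`, would divide
  -- `q x = w * 2 ^ j`. Then `w`, and with it `q`, would be even.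
  f≢0 : ∣ f ∣ ≡ 0 → _
  f≢0 ∣f∣≡0 = odd (ℤ.∣m+n∣n⇒∣m {m = q} (subst (+ 2 ℤ.∣_) (expand q (+ v)) 2∣w) (divides (q ℤ.* + v) refl))
    where
    expand : ∀ q v → q ℤ.* (1ℤ ℤ.+ + 2 ℤ.* v) ≡ q ℤ.+ q ℤ.* v ℤ.* + 2
    expand = ℤ-Ring.solve-∀
    drop : ∀ y → y ℤ.- 0ℤ ≡ y
    drop = ℤ-Ring.solve-∀
    2∣w : + 2 ℤ.∣ w
    2∣w = ℤ.*-cancelʳ-∣ (+ (2 ℕ.^ j)) {{ℕ.m^n≢0 2 j}}
      (subst (ℤ._∣ w ℤ.* + (2 ℕ.^ j)) (ℤ.pos-* 2 (2 ℕ.^ j))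
        (subst (+ (2 ℕ.^ ℕ.suc j) ℤ.∣_)
          (trans (cong (λ f → q ℤ.* + x ℤ.- f) (ℤ.∣i∣≡0⇒i≡0 ∣f∣≡0)) (trans (drop _) qx≡))
          (power-∣ j<n)))

candidate-run-0 : {t : BinaryVector n} → Run 0F j k t →
                  ∀ {m} → Candidate t m → 2 ℕ.^ j ℕ.≤ m
candidate-run-0 r (q , f , (qs≡f , _ , odd) , refl) with value-run-0 r
... | v , eq = ℕ.≤-trans (odd-multiple-≤ {q = q} {f} {v = v} (run-< r) odd eq qs≡f) (ℕ.m≤n⊔m ∣ q ∣ ∣ f ∣)

-- For a run of ones it is f + q, not f, that is an odd multiple of 2 ^ j.
candidate-run-1 : {t : BinaryVector n} → Run 1F j k t →
                  ∀ {m} → Candidate t m → 2 ℕ.^ j ℕ.≤ 2 ℕ.* m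
candidate-run-1 {n} {j} {t = t} r (q , f , (qs≡f , _ , odd) , refl) with value-run-1 r
... | v , eq = begin
  2 ℕ.^ j           ≤⟨ odd-multiple-≤ {q = q} {f ℤ.+ q} {v = v} (run-< r) odd eq
                         (subst (+ (2 ℕ.^ n) ℤ.∣_) (shift q (+ value t) f) qs≡f) ⟩
  -- The triangle inequality costs the factor 2 by which runs of ones contribute less than runs of
  -- zeros.
  ∣ f ℤ.+ q ∣       ≤⟨ ℤ.∣i+j∣≤∣i∣+∣j∣ f q ⟩
  ∣ f ∣ ℕ.+ ∣ q ∣   ≤⟨ ℕ.+-mono-≤ (ℕ.m≤n⊔m ∣ q ∣ ∣ f ∣) (ℕ.m≤m⊔n ∣ q ∣ ∣ f ∣) ⟩
  m ℕ.+ m           ≡⟨ cong (m ℕ.+_) (sym (ℕ.+-identityʳ m)) ⟩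
  2 ℕ.* m           ∎
  where
  open ℕ.≤-Reasoning
  m = ∣ q ∣ ℕ.⊔ ∣ f ∣
  shift : ∀ q x f → q ℤ.* x ℤ.- f ≡ q ℤ.* (x ℤ.+ 1ℤ) ℤ.- (f ℤ.+ q)
  shift = ℤ-Ring.solve-∀

Λ-run-0 : {t : BinaryVector n} → Run 0F j k t → 2 ℕ.^ j ℕ.≤ Λ t
Λ-run-0 {t = t} r = candidate-run-0 r (proj₁ (Λ-isMinimum t))

Λ-run-1 : {t : BinaryVector n} → Run 1F j k t → 2 ℕ.^ j ℕ.≤ 2 ℕ.* Λ t
Λ-run-1 {t = t} r = candidate-run-1 r (proj₁ (Λ-isMinimum t))

-- The difference between `Λ` and `Λˢʸᵐ`.

gain : BinaryVector n → ℕ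
gain s = Λ s ℕ.∸ Λ (reverse s)

-- Thanks to truncated subtraction, `gain` is exactly the nonnegative difference `Λ - Λˢʸᵐ`,
-- whichever of the two complexities is smaller.
Λˢʸᵐ+gain : (s : BinaryVector n) → Λˢʸᵐ s ℕ.+ gain s ≡ Λ s
Λˢʸᵐ+gain s = trans (cong (ℕ._+ gain s) (ℕ.⊓-comm (Λ s) (Λ (reverse s)))) (ℕ.m⊓n+n∸m≡n (Λ (reverse s)) (Λ s))

Λ≤gain+ : (s : BinaryVector n) → Λ (reverse s) ℕ.≤ a → Λ s ℕ.≤ gain s ℕ.+ a
Λ≤gain+ {a = a} s rev≤a = begin
  Λ s                          ≤⟨ ℕ.m≤n+m∸n (Λ s) (Λ (reverse s)) ⟩
  Λ (reverse s) ℕ.+ gain s     ≤⟨ ℕ.+-monoˡ-≤ (gain s) rev≤a ⟩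
  a ℕ.+ gain s                 ≡⟨ ℕ.+-comm a _ ⟩
  gain s ℕ.+ a                 ∎
  where open ℕ.≤-Reasoning

4^k≡2^k*2^k : ∀ k → 4 ℕ.^ k ≡ 2 ℕ.^ k ℕ.* 2 ℕ.^ k
4^k≡2^k*2^k ℕ.zero    = refl
4^k≡2^k*2^k (ℕ.suc k) = trans (cong (4 ℕ.*_) (4^k≡2^k*2^k k)) (square (2 ℕ.^ k))
  where
  square : ∀ p → 4 ℕ.* (p ℕ.* p) ≡ 2 ℕ.* p ℕ.* (2 ℕ.* p)
  square = ℕ-Ring.solve-∀

-- Multiplying `2 ^ j ≤ gain t + 2 ^ (k + 1)` by `2 ^ (k + 1)` makes the left side independent of
-- `k`. This is the hypothesis of `total-runs` with `d = 4`.
gain-run-0 : {t : BinaryVector n} → Run 0F j k t →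
             2 ℕ.^ n ℕ.≤ 2 ℕ.^ k ℕ.* (2 ℕ.* gain t) ℕ.+ 4 ℕ.* 4 ℕ.^ k
gain-run-0 {n} {j} {k} {t} r = begin
  2 ℕ.^ n                                          ≡⟨ sym (2^j*2^1+k r) ⟩
  2 ℕ.^ j ℕ.* 2 ℕ.^ ℕ.suc k                        ≤⟨ ℕ.*-monoˡ-≤ (2 ℕ.^ ℕ.suc k)
                                                        (ℕ.≤-trans (Λ-run-0 r) (Λ≤gain+ t (Λ-reverse-run-0 r))) ⟩
  (gain t ℕ.+ 2 ℕ.* 2 ℕ.^ k) ℕ.* (2 ℕ.* 2 ℕ.^ k)   ≡⟨ expand (gain t) (2 ℕ.^ k) ⟩
  2 ℕ.^ k ℕ.* (2 ℕ.* gain t) ℕ.+ 4 ℕ.* (2 ℕ.^ k ℕ.* 2 ℕ.^ k)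
                                                   ≡⟨ cong (λ q → 2 ℕ.^ k ℕ.* (2 ℕ.* gain t) ℕ.+ 4 ℕ.* q) (sym (4^k≡2^k*2^k k)) ⟩
  2 ℕ.^ k ℕ.* (2 ℕ.* gain t) ℕ.+ 4 ℕ.* 4 ℕ.^ k     ∎
  where
  open ℕ.≤-Reasoning
  expand : ∀ g p → (g ℕ.+ 2 ℕ.* p) ℕ.* (2 ℕ.* p) ≡ p ℕ.* (2 ℕ.* g) ℕ.+ 4 ℕ.* (p ℕ.* p)
  expand = ℕ-Ring.solve-∀

-- As for zeros, but the factor 2 in `Λ-run-1` halves the left side to `2 ^ n` for vectors of length
-- `n + 1`.
gain-run-1 : {t : BinaryVector (ℕ.suc n)} → Run 1F j k t →
             2 ℕ.^ n ℕ.≤ 2 ℕ.^ k ℕ.* (2 ℕ.* gain t) ℕ.+ 4 ℕ.* 4 ℕ.^ k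
gain-run-1 {n} {j} {k} {t} r = ℕ.*-cancelˡ-≤ 2 (begin
  2 ℕ.* 2 ℕ.^ n                                    ≡⟨ sym (2^j*2^1+k r) ⟩
  2 ℕ.^ j ℕ.* 2 ℕ.^ ℕ.suc k                        ≤⟨ ℕ.*-monoˡ-≤ (2 ℕ.^ ℕ.suc k)
                                                        (ℕ.≤-trans (Λ-run-1 r) (ℕ.*-monoʳ-≤ 2 (Λ≤gain+ t (Λ-reverse-run-1 r)))) ⟩
  2 ℕ.* (gain t ℕ.+ 2 ℕ.* 2 ℕ.^ k) ℕ.* (2 ℕ.* 2 ℕ.^ k)
                                                   ≡⟨ expand (gain t) (2 ℕ.^ k) ⟩
  2 ℕ.* (2 ℕ.^ k ℕ.* (2 ℕ.* gain t) ℕ.+ 4 ℕ.* (2 ℕ.^ k ℕ.* 2 ℕ.^ k))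
                                                   ≡⟨ cong (λ q → 2 ℕ.* (2 ℕ.^ k ℕ.* (2 ℕ.* gain t) ℕ.+ 4 ℕ.* q)) (sym (4^k≡2^k*2^k k)) ⟩
  2 ℕ.* (2 ℕ.^ k ℕ.* (2 ℕ.* gain t) ℕ.+ 4 ℕ.* 4 ℕ.^ k) ∎)
  where
  open ℕ.≤-Reasoning
  expand : ∀ g p → 2 ℕ.* (g ℕ.+ 2 ℕ.* p) ℕ.* (2 ℕ.* p) ≡ 2 ℕ.* (p ℕ.* (2 ℕ.* g) ℕ.+ 4 ℕ.* (p ℕ.* p))
  expand = ℕ-Ring.solve-∀

-- Summing over `k` below `⌊ n /2⌋` thus keeps the geometric error within a constant multiple of
-- `2 ^ n`, that is, bounded in the mean.
4^⌊n/2⌋≤2^n : ∀ n → 4 ℕ.^ ℕ.⌊ n /2⌋ ℕ.≤ 2 ℕ.^ n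
4^⌊n/2⌋≤2^n n = begin
  4 ℕ.^ h            ≡⟨ 4^k≡2^k*2^k h ⟩
  2 ℕ.^ h ℕ.* 2 ℕ.^ h ≡⟨ sym (ℕ.^-distribˡ-+-* 2 h h) ⟩
  2 ℕ.^ (h ℕ.+ h)    ≤⟨ ℕ.^-monoʳ-≤ 2 (ℕ.+-monoʳ-≤ h (ℕ.⌊n/2⌋≤⌈n/2⌉ n)) ⟩
  2 ℕ.^ (h ℕ.+ ℕ.⌈ n /2⌉) ≡⟨ cong (2 ℕ.^_) (ℕ.⌊n/2⌋+⌈n/2⌉≡n n) ⟩
  2 ℕ.^ n            ∎
  where
  open ℕ.≤-Reasoning
  h = ℕ.⌊ n /2⌋

n≤1+2⌊n/2⌋ : ∀ n → n ℕ.≤ 1 ℕ.+ 2 ℕ.* ℕ.⌊ n /2⌋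
n≤1+2⌊n/2⌋ ℕ.zero              = ℕ.z≤n
n≤1+2⌊n/2⌋ (ℕ.suc ℕ.zero)      = ℕ.s≤s ℕ.z≤n
n≤1+2⌊n/2⌋ (ℕ.suc (ℕ.suc n)) =
  subst (2 ℕ.+ n ℕ.≤_) (cong ℕ.suc (sym (ℕ.*-suc 2 ℕ.⌊ n /2⌋))) (ℕ.s≤s (ℕ.s≤s (n≤1+2⌊n/2⌋ n)))

total-gain : ∀ n → let N = ℕ.suc n in
             3 ℕ.* N ℕ.* 2 ℕ.^ N ℕ.≤ 8 ℕ.* total (gain {N}) ℕ.+ 22 ℕ.* 2 ℕ.^ N
total-gain n = begin
  3 ℕ.* ℕ.suc n ℕ.* (2 ℕ.* P)                        ≤⟨ ℕ.*-monoˡ-≤ (2 ℕ.* P) (ℕ.*-monoʳ-≤ 3 (ℕ.s≤s (n≤1+2⌊n/2⌋ n))) ⟩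
  -- The term `12 * P` is the cost of rounding `n / 2`; with the two errors `4 * P`, taken four
  -- times, it gives `44 * P = 22 * 2 ^ N`.
  3 ℕ.* (2 ℕ.+ 2 ℕ.* h) ℕ.* (2 ℕ.* P)                ≡⟨ split h P ⟩
  4 ℕ.* (h ℕ.* (2 ℕ.* P) ℕ.+ h ℕ.* P) ℕ.+ 12 ℕ.* P   ≤⟨ ℕ.+-monoˡ-≤ (12 ℕ.* P) (ℕ.*-monoʳ-≤ 4 (ℕ.+-mono-≤ runs-0 runs-1)) ⟩
  4 ℕ.* ((Σ₀ ℕ.+ 4 ℕ.* P) ℕ.+ (Σ₁ ℕ.+ 4 ℕ.* P)) ℕ.+ 12 ℕ.* P
                                                     ≡⟨ collect Σ₀ Σ₁ P ⟩
  4 ℕ.* (Σ₀ ℕ.+ Σ₁) ℕ.+ 22 ℕ.* (2 ℕ.* P)             ≡⟨ cong (λ x → 4 ℕ.* x ℕ.+ 22 ℕ.* (2 ℕ.* P)) Σ₀+Σ₁ ⟩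
  4 ℕ.* (G ℕ.+ G) ℕ.+ 22 ℕ.* (2 ℕ.* P)               ≡⟨ double G (22 ℕ.* (2 ℕ.* P)) ⟩
  8 ℕ.* G ℕ.+ 22 ℕ.* (2 ℕ.* P)                       ∎
  where
  open ℕ.≤-Reasoning
  h = ℕ.⌊ n /2⌋
  P = 2 ℕ.^ n
  G = total (gain {ℕ.suc n})
  X : BinaryVector (ℕ.suc n) → ℕ
  X t = 2 ℕ.* gain t
  Σ₀ = total (X ∘ (0F ∷_))
  Σ₁ = total (X ∘ (1F ∷_))
  error : ∀ x → x ℕ.+ 4 ℕ.* 4 ℕ.^ h ℕ.≤ x ℕ.+ 4 ℕ.* P
  error x = ℕ.+-monoʳ-≤ x (ℕ.*-monoʳ-≤ 4 (4^⌊n/2⌋≤2^n n))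
  -- Fixing the first bit to be the run's own bit makes the families of zeros and of ones disjoint,
  -- so their totals add.
  runs-0 : h ℕ.* (2 ℕ.* P) ℕ.≤ Σ₀ ℕ.+ 4 ℕ.* P
  runs-0 = ℕ.≤-trans (total-runs {d = 4} 0F (ℕ.⌊n/2⌋≤n n) (X ∘ (0F ∷_)) (gain-run-0 ∘ extend)) (error Σ₀)
  runs-1 : h ℕ.* P ℕ.≤ Σ₁ ℕ.+ 4 ℕ.* P
  runs-1 = ℕ.≤-trans (total-runs {d = 4} 1F (ℕ.⌊n/2⌋≤n n) (X ∘ (1F ∷_)) (gain-run-1 ∘ extend)) (error Σ₁)
  Σ₀+Σ₁ : Σ₀ ℕ.+ Σ₁ ≡ G ℕ.+ G
  Σ₀+Σ₁ = trans (sym (total-suc X 0F)) (total-double (gain {ℕ.suc n}))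
  split : ∀ h P → 3 ℕ.* (2 ℕ.+ 2 ℕ.* h) ℕ.* (2 ℕ.* P) ≡ 4 ℕ.* (h ℕ.* (2 ℕ.* P) ℕ.+ h ℕ.* P) ℕ.+ 12 ℕ.* P
  split = ℕ-Ring.solve-∀
  collect : ∀ x y P → 4 ℕ.* ((x ℕ.+ 4 ℕ.* P) ℕ.+ (y ℕ.+ 4 ℕ.* P)) ℕ.+ 12 ℕ.* P ≡ 4 ℕ.* (x ℕ.+ y) ℕ.+ 22 ℕ.* (2 ℕ.* P)
  collect = ℕ-Ring.solve-∀
  double : ∀ g c → 4 ℕ.* (g ℕ.+ g) ℕ.+ c ≡ 8 ℕ.* g ℕ.+ c
  double = ℕ-Ring.solve-∀

-- From sums of natural numbers to rational means.

cross-multiplied-≤ : ∀ a d p m → m ℕ.* p ℕ.≤ 8 ℕ.* d ℕ.+ 22 ℕ.* p →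
  + a ℤ.* + (p ℕ.* 8 ℕ.* 4) ℤ.≤
  ((+ (a ℕ.+ d) ℤ.* + 8 ℤ.+ ℤ.- (+ m) ℤ.* + p) ℤ.* + 4 ℤ.+ + 11 ℤ.* + (p ℕ.* 8)) ℤ.* + p
-- The right side minus the left is `4 p` times the slack in the hypothesis.
cross-multiplied-≤ a d p m bound = ℤ.0≤i-j⇒j≤i (subst (0ℤ ℤ.≤_) (sym difference)
  (subst (ℤ._≤ + (p ℕ.* 4) ℤ.* slack) (ℤ.*-zeroʳ (+ (p ℕ.* 4)))
    (ℤ.*-monoˡ-≤-nonNeg (+ (p ℕ.* 4)) (ℤ.i≤j⇒0≤j-i (ℤ.+≤+ bound)))))
  where
  slack = + (8 ℕ.* d ℕ.+ 22 ℕ.* p) ℤ.- + (m ℕ.* p)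
  identity : ∀ a d p m →
    ((((a ℤ.+ d) ℤ.* + 8 ℤ.+ ℤ.- m ℤ.* p) ℤ.* + 4 ℤ.+ + 11 ℤ.* (p ℤ.* + 8)) ℤ.* p)
      ℤ.- a ℤ.* (p ℤ.* + 8 ℤ.* + 4) ≡
    (p ℤ.* + 4) ℤ.* ((+ 8 ℤ.* d ℤ.+ + 22 ℤ.* p) ℤ.- m ℤ.* p)
  identity = ℤ-Ring.solve-∀
  difference :
    ((+ (a ℕ.+ d) ℤ.* + 8 ℤ.+ ℤ.- (+ m) ℤ.* + p) ℤ.* + 4 ℤ.+ + 11 ℤ.* + (p ℕ.* 8)) ℤ.* + p
      ℤ.- + a ℤ.* + (p ℕ.* 8 ℕ.* 4) ≡
    + (p ℕ.* 4) ℤ.* slack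
  difference = trans
    (cong₂ (λ x y → ((+ (a ℕ.+ d) ℤ.* + 8 ℤ.+ ℤ.- (+ m) ℤ.* + p) ℤ.* + 4 ℤ.+ + 11 ℤ.* x) ℤ.* + p ℤ.- + a ℤ.* y)
      (ℤ.pos-* p 8) (trans (ℤ.pos-* (p ℕ.* 8) 4) (cong (ℤ._* + 4) (ℤ.pos-* p 8))))
    (trans (identity (+ a) (+ d) (+ p) (+ m))
      (sym (cong₂ ℤ._*_ (ℤ.pos-* p 4)
        (cong₂ ℤ._-_ (cong₂ ℤ._+_ (ℤ.pos-* 8 d) (ℤ.pos-* 22 p)) (ℤ.pos-* m p)))))

-- This is `22 / 8`, from the error term and the factor 8 in `total-gain`.
C₀ : ℚ
C₀ = + 11 / 4

fraction-≤ : ∀ a d p m .{{_ : ℕ.NonZero p}} → m ℕ.* p ℕ.≤ 8 ℕ.* d ℕ.+ 22 ℕ.* p →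
             + a / p ≤ + (a ℕ.+ d) / p - + m / 8 + C₀
-- In unnormalised rationals no common factors are cancelled, so the order is literally the
-- cross-multiplied inequality.
fraction-≤ a d p@(ℕ.suc p-1) m bound = ℚ.toℚᵘ-cancel-≤ (begin
  ℚ.toℚᵘ (+ a / p)             ≃⟨ ℚ.toℚᵘ-fromℚᵘ (mkℚᵘ (+ a) p-1) ⟩
  mkℚᵘ (+ a) p-1               ≤⟨ ℚᵘ.*≤* (cross-multiplied-≤ a d p m bound) ⟩
  y ℚᵘ.- z ℚᵘ.+ c              ≃⟨ ℚᵘ.+-congˡ c (ℚᵘ.+-cong (ℚᵘ.≃-sym (ℚ.toℚᵘ-fromℚᵘ y))
                                    (ℚᵘ.-‿cong (ℚᵘ.≃-sym (ℚ.toℚᵘ-fromℚᵘ z)))) ⟩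
  ℚ.toℚᵘ y′ ℚᵘ.- ℚ.toℚᵘ z′ ℚᵘ.+ c ≃⟨ ℚᵘ.+-congˡ c (ℚᵘ.+-congʳ (ℚ.toℚᵘ y′) (ℚᵘ.≃-sym (ℚ.toℚᵘ-homo‿- z′))) ⟩
  _                            ≃⟨ ℚᵘ.+-congˡ c (ℚᵘ.≃-sym (ℚ.toℚᵘ-homo-+ y′ _)) ⟩
  ℚ.toℚᵘ (y′ - z′) ℚᵘ.+ c      ≃⟨ ℚᵘ.≃-sym (ℚ.toℚᵘ-homo-+ (y′ - z′) C₀) ⟩
  ℚ.toℚᵘ (y′ - z′ + C₀)        ∎)
  where
  open ℚᵘ.≤-Reasoning
  y = mkℚᵘ (+ (a ℕ.+ d)) p-1
  z = mkℚᵘ (+ m) 7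
  c = mkℚᵘ (+ 11) 3
  y′ = + (a ℕ.+ d) / p
  z′ = + m / 8

total-Λ : total (Λ {n}) ≡ total (Λˢʸᵐ {n}) ℕ.+ total (gain {n})
total-Λ {n} = trans (total-cong (sym ∘ Λˢʸᵐ+gain {n})) (total-+ (Λˢʸᵐ {n}) gain)

proposition2 : ∃ λ (C : ℚ) → ∀ (N : ℕ) → 2 ℕ.≤ N → Eʳᵃᵗ⁻ˢʸᵐ N ≤ Eʳᵃᵗ N - + (3 ℕ.* N) / 8 + C
proposition2 = C₀ , λ where
  N@(ℕ.suc n) _ →
    subst (λ x → Eʳᵃᵗ⁻ˢʸᵐ N ≤ _/_ (+ x) (2 ℕ.^ N) {{ℕ.m^n≢0 2 N}} - + (3 ℕ.* N) / 8 + C₀) (sym (total-Λ {N}))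
      (fraction-≤ (total (Λˢʸᵐ {N})) (total (gain {N})) (2 ℕ.^ N) (3 ℕ.* N) {{ℕ.m^n≢0 2 N}} (total-gain n))
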